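{- $N_A$ provides an abstract interpretation of the concrete transition system $N_C$, that is: (1) $N_A$ is null-preserving: $N_A(\emptyset)=\emptyset$; (2) $N_A$ is monotonic: for all $S_A,T_A\subseteq\Sigma_{\mathcal{P}}$, $S_A\subseteq T_A$ implies $N_A(S_A)\subseteq N_A(T_A)$; (3) $N_A$ simulates $N_C$: for every set of concrete states $S_C\subseteq\Sigma_{\mathcal{V}}$, $\alpha(N_C(S_C))\subseteq N_A(\alpha(S_C))$.
   Context: **Logic.** Symbols are Boolean, integer, function (mapping integer tuples to integers) or predicate (mapping integer tuples to Booleans) symbols. CLU expressions are given by: Boolean expressions $b ::= \mathbf{true}\mid\mathbf{false}\mid$ Boolean symbol $\mid\neg b\mid b\wedge b\mid t=t\mid t<t\mid p(t,\dots,t)$; integer expressions $t ::=$ lambda-bound variable $\mid$ integer symbol $\mid \mathit{ITE}(b,t,t)$ (if-then-else) $\mid t+c$ ($c$ an integer constant) $\mid f(t,\dots,t)$; predicate expressions $p ::=$ predicate symbol $\mid\lambda x_1,\dots,x_k.\,b$; function expressions $f ::=$ function symbol $\mid \lambda x_1,\dots,x_k.\,t$ (lambda variables are integers). For a set of symbols $\mathcal{A}$, $E(\mathcal{A})$ is the set of CLU expressions over $\mathcal{A}$; $\Sigma_{\mathcal{A}}$ is the set of interpretations $\sigma_{\mathcal{A}}$, each assigning to every symbol of $\mathcal{A}$ a value of the appropriate type; $\langle\theta\rangle_{\sigma_{\mathcal{A}}}$ is the value of $\theta\in E(\mathcal{A})$ under $\sigma_{\mathcal{A}}$. For disjoint $\mathcal{A},\mathcal{B}$,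 $\sigma_{\mathcal{A}}\cdot\sigma_{\mathcal{B}}$ is the combined interpretation of $\mathcal{A}\cup\mathcal{B}$. A named set $v$ over $\mathcal{A}$ of expressions over $\mathcal{B}$ has an expression $v_x\in E(\mathcal{B})$ of the type of $x$ for each $x\in\mathcal{A}$; $\langle v\rangle_{\sigma_{\mathcal{B}}}\in\Sigma_{\mathcal{A}}$ is the interpretation $x\mapsto\langle v_x\rangle_{\sigma_{\mathcal{B}}}$. **Concrete system.** Pairwise disjoint symbol sets: state symbols $\mathcal{V}$, input symbols $\mathcal{I}$, index symbols $\mathcal{X}$, and a finite set $\mathcal{P}$ of Boolean predicate symbols. The next-state behaviour is given by expressions $\delta_x\in E(\mathcal{V}\cup\mathcal{I})$ for each $x\in\mathcal{V}$. Concrete states are elements of $\Sigma_{\mathcal{V}}$; $N_C(s)=\{\langle\delta\rangle_{s\cdot\sigma_{\mathcal{I}}}\mid\sigma_{\mathcal{I}}\in\Sigma_{\mathcal{I}}\}$ and $N_C(S_C)=\bigcup_{s\in S_C}N_C(s)$. **Abstraction.** For each $p\in\mathcal{P}$ there is a Boolean expression $\phi_p\in E(\mathcal{V}\cup\mathcal{X})$; $\phi$ is the named set of these, so $\langle\phi\rangle_{s\cdot\sigma_{\mathcal{X}}}\in\Sigma_{\mathcal{P}}$. Abstract states are elements of $\Sigma_{\mathcal{P}}$. $\alpha(s)=\{\langle\phi\rangle_{s\cdot\sigma_{\mathcal{X}}}\mid\sigma_{\mathcal{X}}\in\Sigma_{\mathcal{X}}\}$, $\alpha(S_C)=\bigcup_{s\in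 S_C}\alpha(s)$, $\gamma(S_A)=\{s\mid\forall\sigma_{\mathcal{X}}\in\Sigma_{\mathcal{X}}:\langle\phi\rangle_{s\cdot\sigma_{\mathcal{X}}}\in S_A\}$, and $N_A(S_A)=\alpha(N_C(\gamma(S_A)))$ for $S_A\subseteq\Sigma_{\mathcal{P}}$. -}

module Defs where

open import Level using (Level; 0ℓ; _⊔_)
open import Data.Bool.Base as Bool using (Bool; if_then_else_)
open import Data.Fin.Base using (Fin)
open import Data.Integer.Base as ℤ using (ℤ)
import Data.Integer.Properties as ℤ
open import Data.Nat.Base as ℕ using (ℕ)
open import Data.Product.Base using (∃-syntax; Σ-syntax; _×_)
open import Data.Sum.Base using (_⊎_; [_,_])
open import Data.Vec.Base using (Vec; []; _∷_; _++_; lookup)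
open import Relation.Binary.PropositionalEquality.Core using (_≡_; _≗_)
open import Relation.Nullary.Decidable.Core using (does)
open import Relation.Unary using (Pred; _∈_)

private
  variable
    ℓ ℓ′ : Level
    k n  : ℕ

data Type : Set where
  boolean integer    : Type
  function predicate : (arity : ℕ) → Type

private
  variable
    τ : Type

Value : Type → Set
Value boolean       = Bool
Value integer       = ℤ
Value (function k)  = Vec ℤ k → ℤ
Value (predicate k) = Vec ℤ k → Bool

record Signature : Set₁ where
  field
    Symbol : Set
    type   : Symbol → Type

open Signature public

-- Symbol sets that are to be disjoint are combined by disjoint union, which
-- is how disjointness is expressed throughout.
_∪_ : Signature → Signature → Signature
Symbol (𝒜 ∪ ℬ) = Symbol 𝒜 ⊎ Symbol ℬ
type   (𝒜 ∪ ℬ) = [ type 𝒜 , type ℬ ]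

booleanSymbols : Set → Signature
Symbol (booleanSymbols A) = A
type   (booleanSymbols A) = λ _ → boolean

-- Expr 𝒜 n τ: expressions of type τ whose free lambda-bound (integer)
-- variables are the de Bruijn indices below n.  A lambda of arity k binds k
-- variables at once, placed in front of the enclosing ones.
data Expr (𝒜 : Signature) (n : ℕ) : Type → Set where
  sym   : (x : Symbol 𝒜) → Expr 𝒜 n (type 𝒜 x)
  true  : Expr 𝒜 n boolean
  false : Expr 𝒜 n boolean
  not   : Expr 𝒜 n boolean → Expr 𝒜 n boolean
  _∧_   : Expr 𝒜 n boolean → Expr 𝒜 n boolean → Expr 𝒜 n boolean
  _==_  : Expr 𝒜 n integer → Expr 𝒜 n integer → Expr 𝒜 n boolean
  _<_   : Expr 𝒜 n integer → Expr 𝒜 n integer → Expr 𝒜 n boolean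
  papp  : Expr 𝒜 n (predicate k) → Vec (Expr 𝒜 n integer) k → Expr 𝒜 n boolean
  var   : Fin n → Expr 𝒜 n integer
  ITE   : Expr 𝒜 n boolean → Expr 𝒜 n integer → Expr 𝒜 n integer → Expr 𝒜 n integer
  _+_   : Expr 𝒜 n integer → (c : ℤ) → Expr 𝒜 n integer
  fapp  : Expr 𝒜 n (function k) → Vec (Expr 𝒜 n integer) k → Expr 𝒜 n integer
  plam  : Expr 𝒜 (k ℕ.+ n) boolean → Expr 𝒜 n (predicate k)
  flam  : Expr 𝒜 (k ℕ.+ n) integer → Expr 𝒜 n (function k)

E : Signature → Type → Set
E 𝒜 τ = Expr 𝒜 0 τ

Interp : Signature → Set
Interp 𝒜 = (x : Symbol 𝒜) → Value (type 𝒜 x)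

-- Equality of values and of interpretations is extensional: it is taken
-- pointwise because function extensionality is not available for _≡_.
ValueEq : (τ : Type) → Value τ → Value τ → Set
ValueEq boolean       = _≡_
ValueEq integer       = _≡_
ValueEq (function k)  = _≗_
ValueEq (predicate k) = _≗_

infix 4 _≈_

_≈_ : {𝒜 : Signature} → Interp 𝒜 → Interp 𝒜 → Set
_≈_ {𝒜} σ σ′ = ∀ x → ValueEq (type 𝒜 x) (σ x) (σ′ x)

infixl 6 _·_

_·_ : {𝒜 ℬ : Signature} → Interp 𝒜 → Interp ℬ → Interp (𝒜 ∪ ℬ)
σ · σ′ = [ σ , σ′ ]

module _ {𝒜 : Signature} (σ : Interp 𝒜) where

  mutual
    eval : Vec ℤ n → Expr 𝒜 n τ → Value τ
    eval ρ (sym x)     = σ x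
    eval ρ true        = Bool.true
    eval ρ false       = Bool.false
    eval ρ (not b)     = Bool.not (eval ρ b)
    eval ρ (b ∧ c)     = eval ρ b Bool.∧ eval ρ c
    eval ρ (t == u)    = does (eval ρ t ℤ.≟ eval ρ u)
    eval ρ (t < u)     = does (eval ρ t ℤ.<? eval ρ u)
    eval ρ (papp p ts) = eval ρ p (evalArgs ρ ts)
    eval ρ (var i)     = lookup ρ i
    eval ρ (ITE b t u) = if eval ρ b then eval ρ t else eval ρ u
    eval ρ (t + c)     = eval ρ t ℤ.+ c
    eval ρ (fapp f ts) = eval ρ f (evalArgs ρ ts)
    eval ρ (plam b)    = λ xs → eval (xs ++ ρ) b
    eval ρ (flam t)    = λ xs → eval (xs ++ ρ) t

    evalArgs : Vec ℤ n → Vec (Expr 𝒜 n integer) k → Vec ℤ k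
    evalArgs ρ []       = []
    evalArgs ρ (t ∷ ts) = eval ρ t ∷ evalArgs ρ ts

⟨_⟩ : {𝒜 : Signature} → E 𝒜 τ → Interp 𝒜 → Value τ
⟨ θ ⟩ σ = eval σ [] θ

NamedSet : Signature → Signature → Set
NamedSet 𝒜 ℬ = (x : Symbol 𝒜) → E ℬ (type 𝒜 x)

⟪_⟫ : {𝒜 ℬ : Signature} → NamedSet 𝒜 ℬ → Interp ℬ → Interp 𝒜
⟪ v ⟫ σ = λ x → ⟨ v x ⟩ σ

⋃[_] : {A B : Set} → (A → Pred B ℓ′) → Pred A ℓ → Pred B (ℓ ⊔ ℓ′)
⋃[ F ] S = λ y → ∃[ x ] (x ∈ S × y ∈ F x)

record ConcreteSystem : Set₁ where
  field
    𝒱 : Signature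
    ℐ : Signature
    δ : NamedSet 𝒱 (𝒱 ∪ ℐ)

  State : Set
  State = Interp 𝒱

  nextStates : State → Pred State 0ℓ
  nextStates s = λ s′ → Σ[ σ ∈ Interp ℐ ] s′ ≈ ⟪ δ ⟫ (s · σ)

  N-C : Pred State ℓ → Pred State ℓ
  N-C = ⋃[ nextStates ]

record Abstraction (C : ConcreteSystem) : Set₁ where
  open ConcreteSystem C

  field
    𝒳     : Signature
    size  : ℕ

  𝒫 : Signature
  𝒫 = booleanSymbols (Fin size)

  field
    φ : NamedSet 𝒫 (𝒱 ∪ 𝒳)

  AbstractState : Set
  AbstractState = Interp 𝒫

  abstractions : State → Pred AbstractState 0ℓ
  abstractions s = λ a → Σ[ σ ∈ Interp 𝒳 ] a ≈ ⟪ φ ⟫ (s · σ)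

  α : Pred State ℓ → Pred AbstractState ℓ
  α = ⋃[ abstractions ]

  γ : Pred AbstractState ℓ → Pred State ℓ
  γ S = λ s → (σ : Interp 𝒳) → ⟪ φ ⟫ (s · σ) ∈ S

  N-A : Pred AbstractState ℓ → Pred AbstractState ℓ
  N-A S = α (N-C (γ S))

{-# OPTIONS --safe #-}

-- γ is monotone, and γ ∅ is empty because Σ_𝒳 is inhabited: this gives (1)
-- and (2).  For (3), S ⊆ γ (α S), and α and N_C are unions of images and
-- hence monotone.
module Submission where

open import Level using (Level)
open import Data.Bool.Base using (false)
open import Data.Integer.Base using (0ℤ)
open import Data.Product.Base using (_×_; _,_; map₁; map₂)
open import Relation.Binary.PropositionalEquality.Core using (refl)
open import Relation.Unary using (Pred; ∅; _⊆_; _≐_)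
open import Defs

-- `N-A` is the composite of `γ`, `N-C` and `α`, all monotone. Simulation is `α ∘ N-C` applied to
-- `S ⊆ γ (α S)`; no converse inclusion, hence no exactness of the abstraction, is involved.

private
  variable
    ℓ ℓ₁ ℓ₂ ℓ′ : Level

-- Every type is inhabited, hence so is `Interp 𝒳`. The universal quantifier in `γ` is thus never
-- vacuous; otherwise `γ ∅` would contain every state.
defaultValue : (τ : Type) → Value τ
defaultValue boolean       = false
defaultValue integer       = 0ℤ
defaultValue (function k)  = λ _ → 0ℤ
defaultValue (predicate k) = λ _ → false

defaultInterp : (𝒜 : Signature) → Interp 𝒜
defaultInterp 𝒜 x = defaultValue (type 𝒜 x)

⋃-mono : {A B : Set} (F : A → Pred B ℓ′) {S : Pred A ℓ₁} {T : Pred A ℓ₂} →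
         S ⊆ T → ⋃[ F ] S ⊆ ⋃[ F ] T
⋃-mono F S⊆T = map₂ (map₁ S⊆T)

module _ {C : ConcreteSystem} (A : Abstraction C) where
  open ConcreteSystem C
  open Abstraction A

  γ-mono : {S : Pred AbstractState ℓ₁} {T : Pred AbstractState ℓ₂} →
           S ⊆ T → γ S ⊆ γ T
  γ-mono S⊆T s∈γS σ = S⊆T (s∈γS σ)

  γ-∅ : γ ∅ ⊆ ∅
  γ-∅ s∈γ∅ = s∈γ∅ (defaultInterp 𝒳)

  S⊆γαS : (S : Pred State ℓ) → S ⊆ γ (α S)
  -- The state and `σ` themselves witness membership in `α S`; `refl` suffices since predicate
  -- symbols are Boolean.
  S⊆γαS S s∈S σ = _ , s∈S , σ , λ _ → refl

  αN-C-mono : {S : Pred State ℓ₁} {T : Pred State ℓ₂} →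
              S ⊆ T → α (N-C S) ⊆ α (N-C T)
  αN-C-mono S⊆T = ⋃-mono abstractions (⋃-mono nextStates S⊆T)

  N-A-∅ : N-A ∅ ⊆ ∅
  N-A-∅ (_ , (s , s∈γ∅ , _) , _) = γ-∅ {s} s∈γ∅

theorem5p1 : {ℓ : Level} (C : ConcreteSystem) (A : Abstraction C) →
    let open ConcreteSystem C
        open Abstraction A
    in (N-A ∅ ≐ ∅)
       × ((S T : Pred AbstractState ℓ) → S ⊆ T → N-A S ⊆ N-A T)
       × ((S : Pred State ℓ) → α (N-C S) ⊆ N-A (α S))
theorem5p1 C A =
  (N-A-∅ A , λ ()) ,
  (λ S T S⊆T → αN-C-mono A (γ-mono A {S = S} {T = T} S⊆T)) ,
  -- `N-A (α S)` unfolds to `α (N-C (γ (α S)))`.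
  (λ S → αN-C-mono A (S⊆γαS A S))
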